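{- Let $n\ge 2$, let $P_n$ be the path on vertices $v_1,\dots,v_n$ with edges $v_iv_{i+1}$ ($1\le i\le n-1$), and let $G'_n$ be the graph obtained from $P_n$ by attaching one pendant vertex $\ell_i$ (adjacent only to $v_i$) to each internal vertex $v_i$ for $2\le i\le n-1$. Then $$\gamma(G'_n)=\max\{1,n-2\},\qquad \zeta(G'_n)=\begin{cases}2,& n=2,\\ 1,& n=3,\\ 2^{\gamma(G'_n)-2},& n\ge 4.\end{cases}$$
   Context: For a finite simple graph $G$, a set $D\subseteq V(G)$ is dominating if every vertex of $G$ lies in $D$ or has a neighbor in $D$. The domination number $\gamma(G)$ is the minimum size of a dominating set. The dominion $\zeta(G)$ is the number of dominating sets of $G$ of size $\gamma(G)$. -}

module Defs where

open import Data.Empty using (⊥)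
open import Data.Fin using (Fin; suc; toℕ; inject₁; splitAt)
open import Data.Fin.Properties using (any?; all?)
  renaming (_≟_ to _≟ᶠ_)
open import Data.Fin.Subset using (Subset; inside; outside; _∈_; ∣_∣; ⊤)
open import Data.Fin.Subset.Properties using (_∈?_; ∈⊤; ∣⊤∣≡n)
open import Data.List using (List; []; _∷_; _++_; map; filter; length)
open import Data.List.Extrema.Nat using (min; argmin-sel; min≤v⁺)
open import Data.List.Membership.Propositional using (lose)
  renaming (_∈_ to _∈ˡ_)
open import Data.List.Membership.Propositional.Properties
  using (∈-++⁺ˡ; ∈-++⁺ʳ; ∈-map⁺; ∈-map⁻; ∈-filter⁺; ∈-filter⁻)
open import Data.List.Relation.Unary.All as All using ()
open import Data.List.Relation.Unary.AllPairs using ([]; _∷_)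
open import Data.List.Relation.Unary.Any using (here)
open import Data.List.Relation.Unary.Unique.Propositional using (Unique)
open import Data.List.Relation.Unary.Unique.Propositional.Properties
  using (map⁺; ++⁺)
open import Data.Nat using (ℕ; zero; suc; _+_; _∸_; _≤_)
open import Data.Nat.Properties using (_≟_; ≤-reflexive; 1+n≢n)
open import Data.Product using (∃; _×_; _,_)
open import Data.Sum using (_⊎_; inj₁; inj₂; swap)
open import Data.Vec using ([]; _∷_)
open import Data.Vec.Properties using (∷-injectiveʳ)
open import Function using (id)
open import Level using (0ℓ)
open import Relation.Binary using (Rel; Symmetric; Irreflexive; Decidable)
open import Relation.Binary.PropositionalEquality
  using (_≡_; refl; sym; trans)
open import Relation.Nullary using (Dec; no)
open import Relation.Nullary.Decidable using (_×-dec_; _⊎-dec_)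

record SimpleGraph : Set₁ where
  field
    order  : ℕ
    Adj    : Rel (Fin order) 0ℓ
    adj?   : Decidable Adj
    symm   : Symmetric Adj
    irrefl : Irreflexive _≡_ Adj

  Vertex : Set
  Vertex = Fin order

open SimpleGraph public

module _ (G : SimpleGraph) where

  Dominating : Subset (order G) → Set
  Dominating D = ∀ v → v ∈ D ⊎ (∃ λ u → u ∈ D × Adj G v u)

  dominating? : ∀ D → Dec (Dominating D)
  dominating? D = all? λ v → (v ∈? D) ⊎-dec any? λ u → (u ∈? D) ×-dec adj? G v u

subsets : ∀ n → List (Subset n)
subsets zero    = [] ∷ []
subsets (suc n) = map (inside ∷_) (subsets n) ++ map (outside ∷_) (subsets n)

module _ (G : SimpleGraph) where

  dominatingSets : List (Subset (order G))
  dominatingSets = filter (dominating? G) (subsets (order G))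

  -- `min` needs a default value; the order of G is harmless, being the size
  -- of the dominating set V(G).
  γ : ℕ
  γ = min (order G) (map ∣_∣ dominatingSets)

  ζ : ℕ
  ζ = length (filter (λ D → ∣ D ∣ ≟ γ) dominatingSets)

∈-subsets : ∀ {n} (D : Subset n) → D ∈ˡ subsets n
∈-subsets []            = here refl
∈-subsets (inside  ∷ D) = ∈-++⁺ˡ (∈-map⁺ (inside ∷_) (∈-subsets D))
∈-subsets (outside ∷ D) = ∈-++⁺ʳ (map (inside ∷_) (subsets _)) (∈-map⁺ (outside ∷_) (∈-subsets D))

subsets-unique : ∀ n → Unique (subsets n)
subsets-unique zero    = All.[] ∷ []
subsets-unique (suc n) =
  ++⁺ (map⁺ ∷-injectiveʳ (subsets-unique n)) (map⁺ ∷-injectiveʳ (subsets-unique n)) disjoint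
  where
  disjoint : ∀ {D} → D ∈ˡ map (inside ∷_) (subsets n) × D ∈ˡ map (outside ∷_) (subsets n) → ⊥
  disjoint (p , q) with ∈-map⁻ (inside ∷_) p | ∈-map⁻ (outside ∷_) q
  ... | _ , _ , refl | _ , _ , ()

module _ (G : SimpleGraph) where

  γ-attained : ∃ λ D → Dominating G D × ∣ D ∣ ≡ γ G
  γ-attained with argmin-sel id (order G) (map ∣_∣ (dominatingSets G))
  ... | inj₁ γ≡order = ⊤ , (λ _ → inj₁ ∈⊤) , trans (∣⊤∣≡n (order G)) (sym γ≡order)
  ... | inj₂ γ∈sizes with ∈-map⁻ ∣_∣ γ∈sizes
  ...   | D , D∈ , γ≡∣D∣ with ∈-filter⁻ (dominating? G) {xs = subsets (order G)} D∈
  ...     | _ , dom = D , dom , sym γ≡∣D∣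

  γ-minimal : ∀ D → Dominating G D → γ G ≤ ∣ D ∣
  γ-minimal D dom = min≤v⁺ (order G) _
    (inj₂ (lose (∈-map⁺ ∣_∣ (∈-filter⁺ (dominating? G) (∈-subsets D) dom)) (≤-reflexive refl)))

path : ℕ → SimpleGraph
path n = record
  { order  = n
  ; Adj    = λ i j → suc (toℕ i) ≡ toℕ j ⊎ suc (toℕ j) ≡ toℕ i
  ; adj?   = λ i j → (suc (toℕ i) ≟ toℕ j) ⊎-dec (suc (toℕ j) ≟ toℕ i)
  ; symm   = swap
  ; irrefl = λ { refl (inj₁ e) → 1+n≢n e ; refl (inj₂ e) → 1+n≢n e }
  }

-- One new vertex for each k : Fin m, adjacent only to s k. In Fin (order G + m)
-- the old vertices come first.
module _ (G : SimpleGraph) {m : ℕ} (s : Fin m → Vertex G) where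

  PendantAdj : Rel (Vertex G ⊎ Fin m) 0ℓ
  PendantAdj (inj₁ u) (inj₁ v) = Adj G u v
  PendantAdj (inj₁ u) (inj₂ k) = u ≡ s k
  PendantAdj (inj₂ k) (inj₁ u) = u ≡ s k
  PendantAdj (inj₂ _) (inj₂ _) = ⊥

  pendantAdj? : Decidable PendantAdj
  pendantAdj? (inj₁ u) (inj₁ v) = adj? G u v
  pendantAdj? (inj₁ u) (inj₂ k) = u ≟ᶠ s k
  pendantAdj? (inj₂ k) (inj₁ u) = u ≟ᶠ s k
  pendantAdj? (inj₂ _) (inj₂ _) = no λ ()

  pendantAdj-sym : Symmetric PendantAdj
  pendantAdj-sym {inj₁ _} {inj₁ _} e = symm G e
  pendantAdj-sym {inj₁ _} {inj₂ _} e = e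
  pendantAdj-sym {inj₂ _} {inj₁ _} e = e

  pendantAdj-irrefl : Irreflexive _≡_ PendantAdj
  pendantAdj-irrefl {inj₁ _} refl e = irrefl G refl e

  attachPendants : SimpleGraph
  attachPendants = record
    { order  = order G + m
    ; Adj    = λ x y → PendantAdj (splitAt (order G) x) (splitAt (order G) y)
    ; adj?   = λ x y → pendantAdj? (splitAt (order G) x) (splitAt (order G) y)
    ; symm   = λ {x} {y} → pendantAdj-sym {splitAt (order G) x} {splitAt (order G) y}
    ; irrefl = λ { {x} refl e → pendantAdj-irrefl {splitAt (order G) x} refl e }
    }

-- Vertex vᵢ of the path is numbered i ∸ 1, so the internal vertices
-- v₂, …, vₙ₋₁ are numbered 1, …, n ∸ 2.
internal : ∀ n → Fin (n ∸ 2) → Vertex (path n)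
internal (suc (suc n)) k = suc (inject₁ k)

G′ : ℕ → SimpleGraph
G′ n = attachPendants (path n) (internal n)

{-# OPTIONS --safe #-}
-- A dominating set must contain vᵢ or its pendant ℓᵢ for every internal vᵢ, so
-- it has at least n ∸ 2 elements. In case of equality it contains exactly one of
-- vᵢ and ℓᵢ for each i and neither end of the path; the ends are then dominated
-- by v₂ and vₙ₋₁, which are therefore forced, while the choice between vᵢ and ℓᵢ
-- is free for 3 ≤ i ≤ n ∸ 2.
module Submission where

open import Defs
open import Data.Fin using (Fin; zero; suc; toℕ; fromℕ; inject₁; splitAt; join)
open import Data.Fin.Properties
  using ( suc-injective; toℕ-injective; toℕ-fromℕ; toℕ-inject₁; toℕ<n; fromℕ≢inject₁
        ; join-splitAt; splitAt-join )
open import Data.Fin.Relation.Unary.Top using (view; ‵fromℕ; ‵inject₁)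
open import Data.Fin.Subset using (Subset; inside; outside; _∈_; _⊆_; ∣_∣; ∁; ⊤)
open import Data.Fin.Subset.Properties
  using ( _∈?_; ∈⊤; ⊆-antisym; p⊆q⇒∣p∣≤∣q∣; p⊂q⇒∣p∣<∣q∣; ∣p∣≤n; ∣p∣≤∣x∷p∣
        ; ∣∁p∣≡n∸∣p∣; x∈∁p⇒x∉p; x∉p⇒x∈∁p )
open import Data.List using (List; length; map; filter)
open import Data.List.Membership.Propositional using () renaming (_∈_ to _∈ˡ_)
open import Data.List.Membership.Propositional.Properties
  using (∈-map⁺; ∈-map⁻; ∈-filter⁺; ∈-filter⁻)
open import Data.List.Membership.Propositional.Properties.WithK using (unique∧set⇒bag)
open import Data.List.Properties using (length-map; length-++)
open import Data.List.Relation.Binary.BagAndSetEquality using (∼bag⇒↭)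
open import Data.List.Relation.Binary.Permutation.Propositional.Properties using (↭-length)
open import Data.List.Relation.Unary.Unique.Propositional using (Unique)
open import Data.List.Relation.Unary.Unique.Propositional.Properties using (map⁺; filter⁺)
open import Data.Nat using (ℕ; zero; suc; _+_; _≤_; _∸_; _⊔_; _^_; s≤s)
open import Data.Nat.Properties
  using ( _≟_; ≤-antisym; ≤-reflexive; ≤-total; ≤-trans; <-irrefl; <⇒≱; +-comm; +-identityʳ
        ; +-monoˡ-≤; +-monoʳ-≤; m≤n+m∸n; m+[n∸m]≡n; m+n≤o⇒m≤o∸n; module ≤-Reasoning )
open import Data.Product using (∃; _×_; _,_)
open import Data.Sum using (_⊎_; inj₁; inj₂; [_,_]′)
open import Data.Vec using ([]; _∷_; here; there; _++_; _∷ʳ_; initLast) renaming (splitAt to splitAtᵛ)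
open import Data.Vec.Properties using (∷-injectiveʳ; ∷ʳ-injectiveˡ; ++-injectiveˡ)
open import Function using (_∘_)
open import Function.Bundles using (mk⇔)
open import Relation.Binary.PropositionalEquality
  using (_≡_; refl; sym; trans; cong; cong₂; subst)
open import Relation.Nullary using (Dec; yes; no; contradiction)

private
  variable
    A     : Set
    k m n : ℕ

-- Counting minimum dominating sets through a parametrization

length-cong-∈ : {xs ys : List A} → Unique xs → Unique ys →
  (∀ {x} → x ∈ˡ xs → x ∈ˡ ys) → (∀ {x} → x ∈ˡ ys → x ∈ˡ xs) → length xs ≡ length ys
length-cong-∈ uxs uys xs⊆ys ys⊆xs =
  ↭-length (∼bag⇒↭ (unique∧set⇒bag uxs uys (mk⇔ xs⊆ys ys⊆xs)))

module _ (G : SimpleGraph) {f : A → Subset (order G)} {xs : List A} where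

  -- The list counted by `ζ` and `map f xs` are both duplicate-free and have the same members, so
  -- they have equal length.
  ζ≡length : Unique xs → (∀ {x y} → f x ≡ f y → x ≡ y) →
    (∀ x → Dominating G (f x)) → (∀ x → ∣ f x ∣ ≡ γ G) →
    (∀ D → Dominating G D → ∣ D ∣ ≡ γ G → ∃ λ x → x ∈ˡ xs × D ≡ f x) →
    ζ G ≡ length xs
  ζ≡length uxs f-inj f-dom ∣f∣≡γ f-surj = trans
    (length-cong-∈
      (filter⁺ minimum? (filter⁺ (dominating? G) (subsets-unique (order G))))
      (map⁺ f-inj uxs) to from)
    (length-map f xs)
    where
    minimum? : ∀ D → Dec (∣ D ∣ ≡ γ G)
    minimum? D = ∣ D ∣ ≟ γ G

    to : ∀ {D} → D ∈ˡ filter minimum? (dominatingSets G) → D ∈ˡ map f xs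
    to {D} D∈ with ∈-filter⁻ minimum? {xs = dominatingSets G} D∈
    ... | D∈dom , ∣D∣≡γ with ∈-filter⁻ (dominating? G) {xs = subsets (order G)} D∈dom
    ...   | _ , dom with f-surj D dom ∣D∣≡γ
    ...     | _ , x∈xs , refl = ∈-map⁺ f x∈xs

    from : ∀ {D} → D ∈ˡ map f xs → D ∈ˡ filter minimum? (dominatingSets G)
    from D∈ with ∈-map⁻ f D∈
    ... | x , _ , refl =
      ∈-filter⁺ minimum? (∈-filter⁺ (dominating? G) (∈-subsets (f x)) (f-dom x)) (∣f∣≡γ x)

length-subsets : ∀ n → length (subsets n) ≡ 2 ^ n
length-subsets zero    = refl
length-subsets (suc n) = trans (length-++ (map (inside ∷_) (subsets n)))
  (cong₂ _+_ (half inside) (trans (half outside) (sym (+-identityʳ _))))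
  where
  half : ∀ x → length (map (x ∷_) (subsets n)) ≡ 2 ^ n
  half x = trans (length-map (x ∷_) (subsets n)) (length-subsets n)

-- Size and membership under `++` and `∷ʳ`

∣++∣ : (p : Subset m) (q : Subset n) → ∣ p ++ q ∣ ≡ ∣ p ∣ + ∣ q ∣
∣++∣ []            q = refl
∣++∣ (inside  ∷ p) q = cong suc (∣++∣ p q)
∣++∣ (outside ∷ p) q = ∣++∣ p q

∣∷ʳ∣ : ∀ (p : Subset n) x → ∣ p ∷ʳ x ∣ ≡ ∣ x ∷ p ∣
∣∷ʳ∣ []            x       = refl
∣∷ʳ∣ (outside ∷ p) inside  = ∣∷ʳ∣ p inside
∣∷ʳ∣ (outside ∷ p) outside = ∣∷ʳ∣ p outside
∣∷ʳ∣ (inside  ∷ p) inside  = cong suc (∣∷ʳ∣ p inside)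
∣∷ʳ∣ (inside  ∷ p) outside = cong suc (∣∷ʳ∣ p outside)

∈-∷ʳ⁺ : ∀ {i} {p : Subset n} {x} → i ∈ p → inject₁ i ∈ p ∷ʳ x
∈-∷ʳ⁺ here        = here
∈-∷ʳ⁺ (there i∈p) = there (∈-∷ʳ⁺ i∈p)

∈-∷ʳ⁻ : ∀ i {p : Subset n} {x} → inject₁ i ∈ p ∷ʳ x → i ∈ p
∈-∷ʳ⁻ zero    {_ ∷ _} here       = here
∈-∷ʳ⁻ (suc i) {_ ∷ _} (there i∈) = there (∈-∷ʳ⁻ i i∈)

last-∈-∷ʳ⁺ : (p : Subset n) → fromℕ n ∈ p ∷ʳ inside
last-∈-∷ʳ⁺ []      = here
last-∈-∷ʳ⁺ (_ ∷ p) = there (last-∈-∷ʳ⁺ p)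

last-∈-∷ʳ⁻ : (p : Subset n) → ∀ {x} → fromℕ n ∈ p ∷ʳ x → x ≡ inside
last-∈-∷ʳ⁻ []      here       = refl
last-∈-∷ʳ⁻ (_ ∷ p) (there n∈) = last-∈-∷ʳ⁻ p n∈

-- Pairs of subsets that cover all indices

Covers : Subset n → Subset n → Set
Covers p q = ∀ i → i ∈ p ⊎ i ∈ q

module _ {p q : Subset n} (cov : Covers p q) where

  covers⇒∁⊆ : ∁ p ⊆ q
  covers⇒∁⊆ {i} i∈∁p with cov i
  ... | inj₁ i∈p = contradiction i∈p (x∈∁p⇒x∉p i∈∁p)
  ... | inj₂ i∈q = i∈q

  covers⇒n≤∣p∣+∣q∣ : n ≤ ∣ p ∣ + ∣ q ∣
  covers⇒n≤∣p∣+∣q∣ = begin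
    n                     ≤⟨ m≤n+m∸n n ∣ p ∣ ⟩
    ∣ p ∣ + (n ∸ ∣ p ∣)   ≡⟨ cong (∣ p ∣ +_) (∣∁p∣≡n∸∣p∣ p) ⟨
    ∣ p ∣ + ∣ ∁ p ∣       ≤⟨ +-monoʳ-≤ ∣ p ∣ (p⊆q⇒∣p∣≤∣q∣ covers⇒∁⊆) ⟩
    ∣ p ∣ + ∣ q ∣         ∎
    where open ≤-Reasoning

  -- By covering, `q` contains `∁ p`, and the size bound leaves no room for a proper inclusion.
  covers-tight : ∣ p ∣ + ∣ q ∣ ≤ n → q ≡ ∁ p
  covers-tight ≤n = ⊆-antisym q⊆∁p covers⇒∁⊆
    where
    ∣q∣≤∣∁p∣ : ∣ q ∣ ≤ ∣ ∁ p ∣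
    ∣q∣≤∣∁p∣ = subst (∣ q ∣ ≤_) (sym (∣∁p∣≡n∸∣p∣ p))
      (m+n≤o⇒m≤o∸n ∣ q ∣ (subst (_≤ n) (+-comm ∣ p ∣ ∣ q ∣) ≤n))

    q⊆∁p : q ⊆ ∁ p
    q⊆∁p {i} i∈q with i ∈? ∁ p
    ... | yes i∈∁p = i∈∁p
    ... | no  i∉∁p =
      contradiction ∣q∣≤∣∁p∣ (<⇒≱ (p⊂q⇒∣p∣<∣q∣ (covers⇒∁⊆ , i , i∈q , i∉∁p)))

-- Domination in a graph with pendants

Mem : Subset m → Subset n → Fin m ⊎ Fin n → Set
Mem p q = [ _∈ p , _∈ q ]′

∈-++⁻ : (p : Subset m) {q : Subset n} {x : Fin (m + n)} → x ∈ p ++ q → Mem p q (splitAt m x)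
∈-++⁻ []      x∈   = x∈
∈-++⁻ (_ ∷ p) here = here
∈-++⁻ {m = suc m} (_ ∷ p) {x = suc x} (there x∈) with splitAt m x | ∈-++⁻ p x∈
... | inj₁ _ | y∈ = there y∈
... | inj₂ _ | y∈ = y∈

∈-++⁺ : (p : Subset m) {q : Subset n} → ∀ y → Mem p q y → join m n y ∈ p ++ q
∈-++⁺ (_ ∷ p) (inj₁ zero)    here       = here
∈-++⁺ (_ ∷ p) (inj₁ (suc y)) (there y∈) = there (∈-++⁺ p (inj₁ y) y∈)
∈-++⁺ []      (inj₂ y)       y∈         = y∈
∈-++⁺ (_ ∷ p) (inj₂ y)       y∈         = there (∈-++⁺ p (inj₂ y) y∈)

module _ (G : SimpleGraph) {m : ℕ} (s : Fin m → Vertex G)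
         (p : Subset (order G)) (q : Subset m) where

  -- Domination over the disjoint union of old vertices and pendants: here matching on `y` and `z`
  -- makes `PendantAdj` compute, whereas the adjacency on `Fin (order G + m)` is stuck on `splitAt`.
  PendantDominating : Set
  PendantDominating = ∀ y → Mem p q y ⊎ (∃ λ z → Mem p q z × PendantAdj G s y z)

  pendantDominating⁻ : Dominating (attachPendants G s) (p ++ q) → PendantDominating
  pendantDominating⁻ dom y with dom (join (order G) m y)
  ... | inj₁ y∈ = inj₁ (subst (Mem p q) (splitAt-join (order G) m y) (∈-++⁻ p y∈))
  ... | inj₂ (u , u∈ , adj) = inj₂ (splitAt (order G) u , ∈-++⁻ p u∈ ,
    subst (λ y → PendantAdj G s y (splitAt (order G) u)) (splitAt-join (order G) m y) adj)

  pendantDominating⁺ : PendantDominating → Dominating (attachPendants G s) (p ++ q)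
  pendantDominating⁺ dom x with dom (splitAt (order G) x)
  ... | inj₁ x∈ = inj₁ (subst (_∈ p ++ q) (join-splitAt (order G) m x) (∈-++⁺ p (splitAt (order G) x) x∈))
  ... | inj₂ (z , z∈ , adj) = inj₂ (join (order G) m z , ∈-++⁺ p z z∈ ,
    subst (PendantAdj G s (splitAt (order G) x)) (sym (splitAt-join (order G) m z)) adj)

-- Dominating sets of `G′` in coordinates

-- The subset of G′ (2 + m) with a, b recording the two ends of the path, p the
-- internal vertices and q their pendants.
assemble : ∀ a b → Subset m → Subset m → Subset ((2 + m) + m)
assemble a b p q = (a ∷ (p ∷ʳ b)) ++ q

disassemble : (D : Subset ((2 + m) + m)) → ∃ λ a → ∃ λ b → ∃ λ (p : Subset m) → ∃ λ q → D ≡ assemble a b p q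
disassemble {m} D with splitAtᵛ (2 + m) D
... | a ∷ r , q , refl with initLast r
...   | p , b , refl = a , b , p , q , refl

∣assemble∣ : ∀ a b (p q : Subset m) → ∣ assemble a b p q ∣ ≡ ∣ a ∷ b ∷ p ∣ + ∣ q ∣
∣assemble∣ a b p q = trans (∣++∣ (a ∷ (p ∷ʳ b)) q) (cong (_+ ∣ q ∣) (∣a∷∣ a))
  where
  ∣a∷∣ : ∀ a → ∣ a ∷ (p ∷ʳ b) ∣ ≡ ∣ a ∷ b ∷ p ∣
  ∣a∷∣ inside  = cong suc (∣∷ʳ∣ p b)
  ∣a∷∣ outside = ∣∷ʳ∣ p b

module _ {a b} (p q : Subset m) (dom : Dominating (G′ (2 + m)) (assemble a b p q)) where

  private
    pdom : PendantDominating (path (2 + m)) (internal (2 + m)) (a ∷ (p ∷ʳ b)) q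
    pdom = pendantDominating⁻ (path (2 + m)) (internal (2 + m)) (a ∷ (p ∷ʳ b)) q dom

  -- A pendant is dominated only by itself or by its sole neighbor, the internal vertex of the same
  -- index.
  dominating⇒covers : Covers p q
  dominating⇒covers i with pdom (inj₂ i)
  ... | inj₁ i∈q                         = inj₂ i∈q
  ... | inj₂ (inj₁ _ , there i∈p , refl) = inj₁ (∈-∷ʳ⁻ i i∈p)

  dominating⇒m≤∣p∣+∣q∣ : m ≤ ∣ p ∣ + ∣ q ∣
  dominating⇒m≤∣p∣+∣q∣ = covers⇒n≤∣p∣+∣q∣ dominating⇒covers

-- The first end carries no pendant, so when left out it can only be dominated by its one neighbor
-- on the path, which is internal since there are at least three path vertices.
first-∈ : ∀ {b} {p q : Subset (suc k)} →
  Dominating (G′ (3 + k)) (assemble outside b p q) → zero ∈ p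
first-∈ {k} {b} {p} {q} dom
  with pendantDominating⁻ (path (3 + k)) (internal (3 + k)) (outside ∷ (p ∷ʳ b)) q dom (inj₁ zero)
... | inj₂ (inj₁ (suc zero) , there 1∈ , inj₁ refl) = ∈-∷ʳ⁻ zero 1∈

last-∈ : ∀ {a} {p q : Subset (suc k)} →
  Dominating (G′ (3 + k)) (assemble a outside p q) → fromℕ k ∈ p
last-∈ {k} {a} {p} {q} dom
  with pendantDominating⁻ (path (3 + k)) (internal (3 + k)) (a ∷ (p ∷ʳ outside)) q dom
         (inj₁ (suc (fromℕ (suc k))))
... | inj₁ (there end∈) = contradiction (last-∈-∷ʳ⁻ p end∈) λ ()
-- A pendant cannot dominate the last vertex, since pendants hang only at internal vertices.
... | inj₂ (inj₂ _ , _ , eq) = contradiction (suc-injective eq) fromℕ≢inject₁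
-- A successor of the last vertex would be numbered `3 + k`, which is out of range.
... | inj₂ (inj₁ u , _ , inj₁ eq) = contradiction (toℕ<n u)
  (<-irrefl (trans (sym eq) (cong (3 +_) (toℕ-fromℕ k))))
... | inj₂ (inj₁ (suc u) , there u∈ , inj₂ eq) = ∈-∷ʳ⁻ (fromℕ k) (subst (_∈ p ∷ʳ outside) u≡ u∈)
  where
  u≡ : u ≡ inject₁ (fromℕ k)
  u≡ = toℕ-injective (trans (cong (_∸ 2) eq) (sym (toℕ-inject₁ (fromℕ k))))

-- The sets with neither end and exactly one of each internal vertex and its pendant; `p` records
-- where the internal vertex is taken.
select : Subset m → Subset ((2 + m) + m)
select p = assemble outside outside p (∁ p)

∣select∣ : (p : Subset m) → ∣ select p ∣ ≡ m
∣select∣ {m} p = trans (∣assemble∣ outside outside p (∁ p))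
  (trans (cong (∣ p ∣ +_) (∣∁p∣≡n∸∣p∣ p)) (m+[n∸m]≡n (∣p∣≤n p)))

select-injective : {p q : Subset m} → select p ≡ select q → p ≡ q
select-injective {p = p} {q} eq = ∷ʳ-injectiveˡ p q
  (∷-injectiveʳ (++-injectiveˡ (outside ∷ (p ∷ʳ outside)) (outside ∷ (q ∷ʳ outside)) eq))

select-dominating : {p : Subset (suc k)} → zero ∈ p → fromℕ k ∈ p →
  Dominating (G′ (3 + k)) (select p)
select-dominating {k} {p} 0∈p k∈p =
  pendantDominating⁺ (path (3 + k)) (internal (3 + k)) (outside ∷ (p ∷ʳ outside)) (∁ p) pdom
  where
  pdom : PendantDominating (path (3 + k)) (internal (3 + k)) (outside ∷ (p ∷ʳ outside)) (∁ p)
  pdom (inj₁ zero) = inj₂ (inj₁ (suc zero) , there (∈-∷ʳ⁺ 0∈p) , inj₁ refl)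
  pdom (inj₁ (suc i)) with view i
  -- The far end of the path, dominated by the last internal vertex.
  ... | ‵fromℕ = inj₂ (inj₁ (suc (inject₁ (fromℕ k))) , there (∈-∷ʳ⁺ k∈p) ,
    inj₂ (cong (2 +_) (toℕ-inject₁ (fromℕ k))))
  ... | ‵inject₁ j with j ∈? p
  ...   | yes j∈p = inj₁ (there (∈-∷ʳ⁺ j∈p))
  ...   | no  j∉p = inj₂ (inj₂ j , x∉p⇒x∈∁p j∉p , refl)
  pdom (inj₂ j) with j ∈? p
  ... | yes j∈p = inj₂ (inj₁ (suc (inject₁ j)) , there (∈-∷ʳ⁺ j∈p) , refl)
  ... | no  j∉p = inj₁ (x∉p⇒x∈∁p j∉p)

-- Covering already uses `m` elements among internal vertices and pendants, so an end would exceed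
-- the bound; without ends, `covers-tight` determines `q`.
dominating-tight : (D : Subset ((2 + m) + m)) → Dominating (G′ (2 + m)) D → ∣ D ∣ ≤ m →
  ∃ λ (p : Subset m) → D ≡ select p
dominating-tight {m} D dom ∣D∣≤m with disassemble {m} D
... | a , b , p , q , refl = ends a b dom (subst (_≤ m) (∣assemble∣ a b p q) ∣D∣≤m)
  where
  ends : ∀ a b → Dominating (G′ (2 + m)) (assemble a b p q) → ∣ a ∷ b ∷ p ∣ + ∣ q ∣ ≤ m →
    ∃ λ (p′ : Subset m) → assemble a b p q ≡ select p′
  ends outside outside dom ≤m =
    p , cong (assemble outside outside p) (covers-tight (dominating⇒covers p q dom) ≤m)
  ends outside inside  dom ≤m = contradiction ≤m (<⇒≱ (s≤s (dominating⇒m≤∣p∣+∣q∣ p q dom)))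
  ends inside  b       dom ≤m = contradiction ≤m (<⇒≱ (s≤s (≤-trans (dominating⇒m≤∣p∣+∣q∣ p q dom)
    (+-monoˡ-≤ ∣ q ∣ (∣p∣≤∣x∷p∣ b p)))))

-- A dominating set with at most `m` elements is some `select p`, which has exactly `m`.
m≤∣dominating∣ : (D : Subset ((2 + m) + m)) → Dominating (G′ (2 + m)) D → m ≤ ∣ D ∣
m≤∣dominating∣ {m} D dom with ≤-total ∣ D ∣ m
... | inj₂ m≤∣D∣ = m≤∣D∣
... | inj₁ ∣D∣≤m with dominating-tight {m} D dom ∣D∣≤m
...   | p , refl = ≤-reflexive (sym (∣select∣ p))

-- The domination number

γ-G′ : ∀ k → γ (G′ (3 + k)) ≡ suc k
γ-G′ k = ≤-antisym upper lower
  where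
  upper : γ (G′ (3 + k)) ≤ suc k
  -- The witness `select ⊤` consists of all internal vertices.
  upper = subst (γ (G′ (3 + k)) ≤_) (∣select∣ {suc k} ⊤)
    (γ-minimal (G′ (3 + k)) (select {suc k} ⊤) (select-dominating ∈⊤ ∈⊤))

  lower : suc k ≤ γ (G′ (3 + k))
  lower with γ-attained (G′ (3 + k))
  ... | D , dom , ∣D∣≡γ = subst (suc k ≤_) ∣D∣≡γ (m≤∣dominating∣ {suc k} D dom)

-- The dominion

-- The forced choices at the two outermost internal vertices, distinct because there are at least
-- two, around the free choices `c` at the others.
extend : Subset k → Subset (2 + k)
extend c = inside ∷ (c ∷ʳ inside)

extend-injective : {c d : Subset k} → extend c ≡ extend d → c ≡ d
extend-injective {c = c} {d} = ∷ʳ-injectiveˡ c d ∘ ∷-injectiveʳ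

extend-surjective : (p : Subset (2 + k)) → zero ∈ p → fromℕ (suc k) ∈ p → ∃ λ c → p ≡ extend c
extend-surjective (_ ∷ r) here (there k∈r) with initLast r
... | c , x , refl with last-∈-∷ʳ⁻ c k∈r
...   | refl = c , refl

dominating-minimum : (D : Subset ((4 + k) + (2 + k))) → Dominating (G′ (4 + k)) D → ∣ D ∣ ≤ 2 + k →
  ∃ λ (c : Subset k) → D ≡ select (extend c)
dominating-minimum {k} D dom ≤2+k with dominating-tight {2 + k} D dom ≤2+k
... | p , refl with extend-surjective p (first-∈ dom) (last-∈ dom)
...   | c , refl = c , refl

ζ-G′ : ∀ k → ζ (G′ (4 + k)) ≡ 2 ^ k
ζ-G′ k = trans
  (ζ≡length (G′ (4 + k)) (subsets-unique k) (extend-injective ∘ select-injective)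
    (λ c → select-dominating here (there (last-∈-∷ʳ⁺ c)))
    (λ c → trans (∣select∣ (extend c)) (sym (γ-G′ (suc k))))
    λ D dom ∣D∣≡γ → let c , eq = dominating-minimum {k} D dom (≤-reflexive (trans ∣D∣≡γ (γ-G′ (suc k))))
                    in c , ∈-subsets c , eq)
  (length-subsets k)

theorem6 : ∀ (n : ℕ) → 2 ≤ n →
    γ (G′ n) ≡ 1 ⊔ (n ∸ 2)
    × (n ≡ 2 → ζ (G′ n) ≡ 2)
    × (n ≡ 3 → ζ (G′ n) ≡ 1)
    × (4 ≤ n → ζ (G′ n) ≡ 2 ^ (γ (G′ n) ∸ 2))
theorem6 1 (s≤s ())
-- For `n = 2` the graph is a single edge and for `n = 3` a star with three leaves; both are settled
-- by evaluation.
theorem6 2 _ = refl , (λ _ → refl) , (λ ()) , λ { (s≤s (s≤s ())) }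
theorem6 3 _ = refl , (λ ()) , (λ _ → refl) , λ { (s≤s (s≤s (s≤s ()))) }
theorem6 (suc (suc (suc (suc k)))) _ =
  γ-G′ (suc k) , (λ ()) , (λ ()) ,
  -- Here `γ` is `2 + k`, so the exponent `γ ∸ 2` is the number `k` of free choices.
  λ _ → trans (ζ-G′ k) (cong (λ g → 2 ^ (g ∸ 2)) (sym (γ-G′ (suc k))))
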